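{- Let $\lambda\in[0,1]$, $\alpha,\beta\ge 1$, and let $\mathcal O$ be an $\alpha$-competitive, $\beta$-feasible online algorithm for the online concave packing problem. Consider any instance $(g,A,b)$ and any advice $y'\in\mathbb{R}^m_{\ge 0}$, and let $\bar y$ be the final solution produced by Algorithm 1 (described in the context) run with $\mathcal O$, $y'$, $\lambda$, $\beta$. Then: (i) $A^T\bar y\le (2-\lambda)\beta\, b$; (ii) $g(\bar y)\ge \frac{\lambda}{\alpha}\,\mathsf{OPT}$; (iii) if moreover $A^T y'\le \beta b$, then $g(\bar y)\ge (1-\lambda)\, g(y')$.
   Context: Online concave packing: maximize $g(y)$ over $y\in\mathbb{R}^m_{\ge 0}$ subject to $A^Ty\le b$, where $A=(a_{ij})\in\mathbb{R}^{m\times n}_{\ge 0}$, $b\in\mathbb{R}^n_{>0}$, and $g:\mathbb{R}^m_{\ge0}\to\mathbb{R}_{\ge0}$ is concave and monotone (coordinatewise non-decreasing) with $g(\mathbf 0)=0$. Vector inequalities are coordinatewise. In the online setting $g$, $b$ and $n$ are known in advance; in round $i=1,2,\dots$ the variable $y_i$ and the $i$-th row $(a_{i1},\dots,a_{in})$ of $A$ are revealed, and the algorithm must irrevocably fix $y_i$ using only information revealed so far; $m$ may be unknown. $\mathsf{OPT}$ denotes the optimal offline value $\sup\{g(y): y\ge 0, A^Ty\le b\}$. An online algorithm is $\alpha$-competitive and $\beta$-feasible if on every instance its output $y^{\mathcal O}$ satisfies $g(y^{\mathcal O})\ge \mathsf{OPT}/\alpha$ and $A^Ty^{\mathcal O}\le\beta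 b$. Algorithm 1: run $\mathcal O$ in parallel on the same input. In round $i$, after row $i$ arrives, obtain $\mathcal O$'s value $y_i^{\mathcal O}$. If the advice restricted to the rounds seen so far is $\beta$-feasible, i.e. $\sum_{k=1}^i a_{kj}y'_k\le \beta b_j$ for all $j\in[n]$, set $y_i=\lambda y_i^{\mathcal O}+(1-\lambda)y'_i$; otherwise set $y_i=y_i^{\mathcal O}$. The final solution $\bar y$ is the vector of all $y_i$. -}

module Defs where

open import Level using (Level; _⊔_; suc)
open import Algebra.Bundles using (CommutativeRing)
open import Algebra.Structures using (IsCommutativeRing)
import Algebra.Properties.Semiring.Sum as SemiringSum
open import Data.Bool.Base using (if_then_else_)
open import Data.Fin.Base using (Fin; toℕ; inject≤)
open import Data.Fin.Properties using (toℕ<n; all?)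
import Data.Nat.Base as ℕ
open ℕ using (ℕ)
open import Data.Product.Base using (Σ; Σ-syntax; ∃; ∃-syntax; _×_; _,_; proj₁; proj₂)
open import Data.Vec.Functional using (Vector)
open import Relation.Binary.Bundles using (DecTotalOrder)
open import Relation.Binary.Core using (Rel)
open import Relation.Binary.Structures using (IsDecTotalOrder)
import Relation.Binary.Construct.Add.Supremum.NonStrict as AddSupremum
import Relation.Binary.Construct.NonStrictToStrict as ToStrict
open import Relation.Nullary.Construct.Add.Supremum using (_⁺; ⊤⁺; [_])
open import Relation.Nullary.Decidable.Core using (Dec; does)
open import Relation.Nullary.Negation.Core using (¬_)
open import Relation.Unary using (Pred)

-- The classical real numbers, axiomatised up to isomorphism as a complete
-- (decidably) totally ordered field.  The least-upper-bound axiom is phrased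
-- with suprema in ℝ ∪ {∞}: every inhabited set of reals has a least upper
-- bound there, which is finite exactly when the set is bounded above.
-- The value of _⁻¹ at 0# is unspecified.
record RealNumbers c ℓ₁ ℓ₂ : Set (suc (c ⊔ ℓ₁ ⊔ ℓ₂)) where
  infix  8 _⁻¹
  infix  8 -_
  infixl 7 _*_
  infixl 6 _+_ _-_
  infix  4 _≈_ _≤_

  field
    Carrier : Set c
    _≈_     : Rel Carrier ℓ₁
    _≤_     : Rel Carrier ℓ₂
    _+_     : Carrier → Carrier → Carrier
    _*_     : Carrier → Carrier → Carrier
    -_      : Carrier → Carrier
    0#      : Carrier
    1#      : Carrier
    _⁻¹     : Carrier → Carrier

    isCommutativeRing : IsCommutativeRing _≈_ _+_ _*_ -_ 0# 1#
    0≉1               : ¬ (0# ≈ 1#)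
    *-inverseʳ        : ∀ {x} → ¬ (x ≈ 0#) → x * x ⁻¹ ≈ 1#

    isDecTotalOrder : IsDecTotalOrder _≈_ _≤_
    +-monoˡ-≤       : ∀ {x y} z → x ≤ y → x + z ≤ y + z
    *-nonNegative   : ∀ {x y} → 0# ≤ x → 0# ≤ y → 0# ≤ x * y

  open AddSupremum _≤_ public using (_≤⁺_; [_]; _≤⊤⁺)

  IsSup : Pred Carrier (c ⊔ ℓ₁ ⊔ ℓ₂) → Carrier ⁺ → Set (c ⊔ ℓ₁ ⊔ ℓ₂)
  IsSup S u = (∀ x → S x → [ x ] ≤⁺ u)
            × (∀ v → (∀ x → S x → [ x ] ≤⁺ v) → u ≤⁺ v)

  field
    ⨆       : (S : Pred Carrier (c ⊔ ℓ₁ ⊔ ℓ₂)) → ∃ S → Carrier ⁺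
    ⨆-isSup : ∀ S (inhabited : ∃ S) → IsSup S (⨆ S inhabited)

  _-_ : Carrier → Carrier → Carrier
  x - y = x + (- y)

  open ToStrict _≈_ _≤_ public using (_<_)

  commutativeRing : CommutativeRing c ℓ₁
  commutativeRing = record { isCommutativeRing = isCommutativeRing }

  decTotalOrder : DecTotalOrder c ℓ₁ ℓ₂
  decTotalOrder = record { isDecTotalOrder = isDecTotalOrder }

  open IsDecTotalOrder isDecTotalOrder public using (_≟_; _≤?_)


module OnlinePacking {c ℓ₁ ℓ₂} (R : RealNumbers c ℓ₁ ℓ₂) where

  open RealNumbers R renaming (Carrier to ℝ)
  private
    module CR = CommutativeRing commutativeRing
    module ≤  = DecTotalOrder decTotalOrder
  open SemiringSum CR.semiring using (sum; sum-cong-≋; sum-replicate-zero)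

  ℝ≥0 : Set (c ⊔ ℓ₂)
  ℝ≥0 = Σ[ x ∈ ℝ ] 0# ≤ x

  ℝ>0 : Set (c ⊔ ℓ₁ ⊔ ℓ₂)
  ℝ>0 = Σ[ x ∈ ℝ ] 0# < x

  [0,1] : Set (c ⊔ ℓ₂)
  [0,1] = Σ[ t ∈ ℝ ] (0# ≤ t × t ≤ 1#)

  0≥0 : ℝ≥0
  0≥0 = 0# , ≤.refl

  -- Multiplication of an extended real by a nonnegative real, with 0 · ∞ = 0.
  infixr 7 _·_
  _·_ : ℝ → ℝ ⁺ → ℝ ⁺
  r · [ x ] = [ r * x ]
  r · ⊤⁺    = if does (r ≟ 0#) then [ 0# ] else ⊤⁺

  private
    +-nonNegative : ∀ {x y} → 0# ≤ x → 0# ≤ y → 0# ≤ x + y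
    +-nonNegative {x} {y} 0≤x 0≤y =
      ≤.trans 0≤y (≤.≤-respˡ-≈ (CR.+-identityˡ y) (+-monoˡ-≤ y 0≤x))

    1-t-nonNegative : ∀ {t} → t ≤ 1# → 0# ≤ 1# - t
    1-t-nonNegative {t} t≤1 =
      ≤.≤-respˡ-≈ (CR.-‿inverseʳ t) (+-monoˡ-≤ (- t) t≤1)

  mix : [0,1] → ℝ≥0 → ℝ≥0 → ℝ≥0
  mix (t , 0≤t , t≤1) (x , 0≤x) (y , 0≤y) =
      t * x + (1# - t) * y
    , +-nonNegative (*-nonNegative 0≤t 0≤x)
                    (*-nonNegative (1-t-nonNegative t≤1) 0≤y)

  record IsObjective {m} (g : Vector ℝ≥0 m → ℝ≥0) : Set (c ⊔ ℓ₁ ⊔ ℓ₂) where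
    field
      concave  : ∀ (t : [0,1]) x y →
                 proj₁ (mix t (g x) (g y)) ≤ proj₁ (g (λ i → mix t (x i) (y i)))
      monotone : ∀ {x y} → (∀ i → proj₁ (x i) ≤ proj₁ (y i)) →
                 proj₁ (g x) ≤ proj₁ (g y)
      at-zero  : proj₁ (g (λ _ → 0≥0)) ≈ 0#

  Objective : ℕ → Set (c ⊔ ℓ₁ ⊔ ℓ₂)
  Objective m = Σ[ g ∈ (Vector ℝ≥0 m → ℝ≥0) ] IsObjective g

  Matrix : ℕ → ℕ → Set (c ⊔ ℓ₂)
  Matrix m n = Vector (Vector ℝ≥0 n) m

  record Instance : Set (c ⊔ ℓ₁ ⊔ ℓ₂) where
    field
      {m n}     : ℕ
      objective : Objective m
      A         : Matrix m n
      b         : Vector ℝ>0 n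

    g : Vector ℝ≥0 m → ℝ
    g y = proj₁ (proj₁ objective y)

    bound : Vector ℝ n
    bound j = proj₁ (b j)

  infixr 8 _ᵀ_
  _ᵀ_ : ∀ {m n} → Matrix m n → Vector ℝ≥0 m → Vector ℝ n
  (A ᵀ y) j = sum (λ i → proj₁ (A i j) * proj₁ (y i))

  infix 4 _≤ᵛ_ _≤ᵛ?_
  _≤ᵛ_ : ∀ {n} → Vector ℝ n → Vector ℝ n → Set ℓ₂
  u ≤ᵛ v = ∀ j → u j ≤ v j

  _≤ᵛ?_ : ∀ {n} (u v : Vector ℝ n) → Dec (u ≤ᵛ v)
  u ≤ᵛ? v = all? (λ j → u j ≤? v j)

  infixr 7 _*ᵛ_
  _*ᵛ_ : ∀ {n} → ℝ → Vector ℝ n → Vector ℝ n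
  (r *ᵛ v) j = r * v j

  module _ (I : Instance) where
    open Instance I

    AchievableValue : Pred ℝ (c ⊔ ℓ₁ ⊔ ℓ₂)
    AchievableValue v = ∃[ y ] (A ᵀ y ≤ᵛ bound × v ≈ g y)

    achievable-inhabited : ∃ AchievableValue
    achievable-inhabited = g (λ _ → 0≥0) , (λ _ → 0≥0) , feasible , CR.refl
      where
      feasible : A ᵀ (λ _ → 0≥0) ≤ᵛ bound
      feasible j = ≤.≤-respˡ-≈
        (CR.sym (CR.trans (sum-cong-≋ (λ i → CR.zeroʳ (proj₁ (A i j))))
                          (sum-replicate-zero m)))
        (proj₁ (proj₂ (b j)))

    OPT : ℝ ⁺
    OPT = ⨆ AchievableValue achievable-inhabited

  -- The entries with index at most i; rounds are numbered from 0, so in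
  -- round i there are suc (toℕ i) of them.
  upToRound : ∀ {a} {X : Set a} {m} (i : Fin m) → Vector X m → Vector X (ℕ.suc (toℕ i))
  upToRound i v k = v (inject≤ k (toℕ<n i))

  -- A deterministic online algorithm chooses the value of variable i as a
  -- function of the data known in advance and rows 0, …, i.  Its own earlier
  -- choices are determined by the same data.  As g determines m, the
  -- algorithm may use m; one that does not know m is one that ignores it.
  OnlineAlgorithm : Set (c ⊔ ℓ₁ ⊔ ℓ₂)
  OnlineAlgorithm = ∀ {m n} → Objective m → Vector ℝ>0 n →
                    (i : Fin m) → Matrix (ℕ.suc (toℕ i)) n → ℝ≥0

  output : OnlineAlgorithm → (I : Instance) → Vector ℝ≥0 (Instance.m I)
  output 𝒪 I i = 𝒪 objective b i (upToRound i A)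
    where open Instance I

  -- Competitiveness and feasibility are relative to a class 𝓒 of instances.
  -- Taking 𝓒 to be everything gives the guarantee on all instances; other
  -- choices let α and β depend on instance parameters such as m and n, or
  -- leave out instances with OPT = ∞ (where no α-competitive output exists).
  Competitive : ∀ {p} → Pred Instance p → ℝ → OnlineAlgorithm → Set _
  Competitive 𝓒 α 𝒪 =
    ∀ I → 𝓒 I → (α ⁻¹ · OPT I) ≤⁺ [ Instance.g I (output 𝒪 I) ]

  Feasible : ∀ {p} → Pred Instance p → ℝ → OnlineAlgorithm → Set _
  Feasible 𝓒 β 𝒪 =
    ∀ I → 𝓒 I → Instance.A I ᵀ output 𝒪 I ≤ᵛ β *ᵛ Instance.bound I

  -- The weight t is the λ of the algorithm and y′ is the advice.
  algorithm1 : OnlineAlgorithm → [0,1] → ℝ → (I : Instance) →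
               Vector ℝ≥0 (Instance.m I) → Vector ℝ≥0 (Instance.m I)
  algorithm1 𝒪 t β I y′ i =
    if does (upToRound i A ᵀ upToRound i y′ ≤ᵛ? β *ᵛ bound)
    then mix t (output 𝒪 I i) (y′ i)
    else output 𝒪 I i
    where open Instance I

{-# OPTIONS --safe #-}
-- Both guarantees on the objective value compare ȳ with a convex combination
-- in which concavity applies: ȳ dominates λ yᴼ + (1 − λ) 0, and it equals
-- λ yᴼ + (1 − λ) y′ when y′ is β-feasible, since then every prefix is too.
-- For feasibility, ȳ ≤ yᴼ + (1 − λ) z, where z is the advice with the
-- discarded rounds set to 0.  The load of z is at most that of the advice up
-- to the last accepted round, which passed the test of the algorithm.
module Submission where

open import Defs
open import Algebra.Bundles using (CommutativeRing)
import Algebra.Properties.Semiring.Sum as SemiringSum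
open import Data.Bool.Base using (Bool; true; false; if_then_else_)
open import Data.Fin.Base using (Fin; zero; suc)
open import Data.Nat.Base using (ℕ)
open import Data.Product.Base using (∃-syntax; _×_; _,_; proj₁; proj₂)
open import Data.Sum.Base using (_⊎_; inj₁; inj₂)
open import Data.Vec.Functional using (Vector)
open import Function.Base using (_∘_)
open import Relation.Binary.Bundles using (DecTotalOrder)
open import Relation.Binary.PropositionalEquality.Core using (_≡_; cong; sym)
import Relation.Binary.Reasoning.PartialOrder as PosetReasoning
open import Relation.Nullary.Construct.Add.Supremum using (_⁺; ⊤⁺; [_])
open import Relation.Nullary.Decidable.Core using (Dec; does; yes; no)
open import Relation.Nullary.Decidable using (dec-true)
open import Relation.Nullary.Negation.Core using (¬_; contradiction)
open import Relation.Unary using (Pred; Decidable)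

if-does-true : ∀ {p a} {P : Set p} {X : Set a} (P? : Dec P) → P → {x y : X} →
               (if does P? then x else y) ≡ x
if-does-true P? p {x} {y} = cong (λ d → if d then x else y) (dec-true P? p)

-- Ordered-field inequalities, including scaling of extended reals.

module OrderedField {c ℓ₁ ℓ₂} (R : RealNumbers c ℓ₁ ℓ₂) where

  open RealNumbers R renaming (Carrier to ℝ)
  open OnlinePacking R
  private
    module CR = CommutativeRing commutativeRing
    module ≤  = DecTotalOrder decTotalOrder
  open SemiringSum CR.semiring
  open PosetReasoning ≤.poset

  +-monoʳ-≤ : ∀ z {x y} → x ≤ y → z + x ≤ z + y
  +-monoʳ-≤ z {x} {y} x≤y = begin
    z + x  ≈⟨ CR.+-comm z x ⟩
    x + z  ≤⟨ +-monoˡ-≤ z x≤y ⟩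
    y + z  ≈⟨ CR.+-comm y z ⟩
    z + y  ∎

  +-mono-≤ : ∀ {w x y z} → w ≤ x → y ≤ z → w + y ≤ x + z
  +-mono-≤ {x = x} {y} w≤x y≤z = ≤.trans (+-monoˡ-≤ y w≤x) (+-monoʳ-≤ x y≤z)

  x≤x+y : ∀ x {y} → 0# ≤ y → x ≤ x + y
  x≤x+y x 0≤y = ≤.≤-respˡ-≈ (CR.+-identityʳ x) (+-monoʳ-≤ x 0≤y)

  x≤y+x : ∀ x {y} → 0# ≤ y → x ≤ y + x
  x≤y+x x 0≤y = ≤.≤-respˡ-≈ (CR.+-identityˡ x) (+-monoˡ-≤ x 0≤y)

  x≤y⇒0≤y-x : ∀ {x y} → x ≤ y → 0# ≤ y - x
  x≤y⇒0≤y-x {x} x≤y = ≤.≤-respˡ-≈ (CR.-‿inverseʳ x) (+-monoˡ-≤ (- x) x≤y)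

  [y-x]+x≈y : ∀ x y → (y - x) + x ≈ y
  [y-x]+x≈y x y = begin-equality
    (y - x) + x    ≈⟨ CR.+-assoc y (- x) x ⟩
    y + (- x + x)  ≈⟨ CR.+-congˡ (CR.-‿inverseˡ x) ⟩
    y + 0#         ≈⟨ CR.+-identityʳ y ⟩
    y              ∎

  *-monoˡ-≤ : ∀ {z x y} → 0# ≤ z → x ≤ y → z * x ≤ z * y
  *-monoˡ-≤ {z} {x} {y} 0≤z x≤y = begin
    z * x                ≤⟨ x≤y+x _ (*-nonNegative 0≤z (x≤y⇒0≤y-x x≤y)) ⟩
    z * (y - x) + z * x  ≈⟨ CR.distribˡ z (y - x) x ⟨
    z * ((y - x) + x)    ≈⟨ CR.*-congˡ ([y-x]+x≈y x y) ⟩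
    z * y                ∎

  *-shrinks : ∀ {t x} → t ≤ 1# → 0# ≤ x → t * x ≤ x
  *-shrinks {t} {x} t≤1 0≤x = begin
    t * x   ≈⟨ CR.*-comm t x ⟩
    x * t   ≤⟨ *-monoˡ-≤ 0≤x t≤1 ⟩
    x * 1#  ≈⟨ CR.*-identityʳ x ⟩
    x       ∎

  1≤x⇒x⁻¹≉0 : ∀ {x} → 0# ≤ 1# → 1# ≤ x → ¬ (x ⁻¹ ≈ 0#)
  1≤x⇒x⁻¹≉0 {x} 0≤1 1≤x x⁻¹≈0 = 0≉1 (begin-equality
    0#        ≈⟨ CR.zeroʳ x ⟨
    x * 0#    ≈⟨ CR.*-congˡ x⁻¹≈0 ⟨
    x * x ⁻¹  ≈⟨ *-inverseʳ x≉0 ⟩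
    1#        ∎)
    where
    x≉0 : ¬ (x ≈ 0#)
    x≉0 x≈0 = 0≉1 (≤.antisym 0≤1 (≤.≤-respʳ-≈ x≈0 1≤x))

  -- Carries the competitive guarantee over to the scaled factor. If `u` is infinite, `r ≉ 0` turns
  -- `r · u` into `⊤⁺`, which lies below no real, so the assumed bound is absurd.
  ·-scale-≤⁺ : ∀ {t r v w} (u : ℝ ⁺) → 0# ≤ t → ¬ (r ≈ 0#) →
               r · u ≤⁺ [ v ] → t * v ≤ w → (t * r) · u ≤⁺ [ w ]
  ·-scale-≤⁺ {t} {r} {v} {w} [ x ] 0≤t r≉0 [ rx≤v ] tv≤w = [ (begin
    (t * r) * x  ≈⟨ CR.*-assoc t r x ⟩
    t * (r * x)  ≤⟨ *-monoˡ-≤ 0≤t rx≤v ⟩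
    t * v        ≤⟨ tv≤w ⟩
    w            ∎) ]
  ·-scale-≤⁺ {r = r} ⊤⁺ 0≤t r≉0 ru≤v tv≤w with r ≟ 0#
  ... | yes r≈0 = contradiction r≈0 r≉0
  ·-scale-≤⁺ {r = r} ⊤⁺ 0≤t r≉0 () tv≤w | no _

  -- Sums of nonnegative vectors, their prefixes and their masks.

  sum-mono-≤ : ∀ {n} {u v : Vector ℝ n} → u ≤ᵛ v → sum u ≤ sum v
  sum-mono-≤ {ℕ.zero}  u≤v = ≤.refl
  sum-mono-≤ {ℕ.suc n} u≤v = +-mono-≤ (u≤v zero) (sum-mono-≤ (u≤v ∘ suc))

  sum-nonNegative : ∀ {n} {v : Vector ℝ n} → (∀ i → 0# ≤ v i) → 0# ≤ sum v
  sum-nonNegative {n} 0≤v = ≤.≤-respˡ-≈ (sum-replicate-zero n) (sum-mono-≤ 0≤v)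

  sum-upToRound-≤ : ∀ {m} {v : Vector ℝ m} → (∀ i → 0# ≤ v i) →
                    ∀ i → sum (upToRound i v) ≤ sum v
  -- The prefix of round `zero` has one entry, so its sum unfolds to `v zero + 0#`.
  sum-upToRound-≤ {v = v} 0≤v zero    = +-monoʳ-≤ (v zero) (sum-nonNegative (0≤v ∘ suc))
  sum-upToRound-≤ {v = v} 0≤v (suc i) = +-monoʳ-≤ (v zero) (sum-upToRound-≤ (0≤v ∘ suc) i)

  -- Branching on `does` makes the entries agree definitionally with the advice term in
  -- `choice-load`.
  mask : ∀ {p m} {P : Pred (Fin m) p} → Decidable P → Vector ℝ m → Vector ℝ m
  mask P? v i = if does (P? i) then v i else 0#

  mask-≤ : ∀ {p m} {P : Pred (Fin m) p} (P? : Decidable P) {v : Vector ℝ m} →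
           (∀ i → 0# ≤ v i) → mask P? v ≤ᵛ v
  mask-≤ P? 0≤v i with does (P? i)
  ... | true  = ≤.refl
  ... | false = 0≤v i

  -- The witness in the second case is the last index satisfying P.
  sum-mask : ∀ {p m} {P : Pred (Fin m) p} (P? : Decidable P) {v : Vector ℝ m} →
             (∀ i → 0# ≤ v i) →
             sum (mask P? v) ≈ 0# ⊎ (∃[ i ] P i × sum (mask P? v) ≤ sum (upToRound i v))
  sum-mask {m = ℕ.zero}  P? 0≤v = inj₁ CR.refl
  sum-mask {m = ℕ.suc m} P? {v} 0≤v with sum-mask (P? ∘ suc) (0≤v ∘ suc)
  ... | inj₂ (i , Pi , ≤prefix) =
    inj₂ (suc i , Pi , +-mono-≤ (mask-≤ P? 0≤v zero) ≤prefix)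
  ... | inj₁ rest≈0 with P? zero
  ...   | yes P0 = inj₂ (zero , P0 , +-monoʳ-≤ (v zero) (≤.reflexive rest≈0))
  ...   | no  _  = inj₁ (CR.trans (CR.+-identityˡ _) rest≈0)

  -- Masked terms vanish after the last index satisfying `P` and only shrink before it, so the
  -- prefix bound at that index suffices. `0# ≤ B` settles the case of a zero masked sum.
  sum-mask-≤ : ∀ {p m} {P : Pred (Fin m) p} (P? : Decidable P) {v : Vector ℝ m} {B} →
               (∀ i → 0# ≤ v i) → 0# ≤ B → (∀ i → P i → sum (upToRound i v) ≤ B) →
               sum (mask P? v) ≤ B
  sum-mask-≤ P? 0≤v 0≤B prefix≤B with sum-mask P? 0≤v
  ... | inj₁ ≈0                 = ≤.≤-respˡ-≈ (CR.sym ≈0) 0≤B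
  ... | inj₂ (i , Pi , ≤prefix) = ≤.trans ≤prefix (prefix≤B i Pi)

module Analysis {c ℓ₁ ℓ₂} (R : RealNumbers c ℓ₁ ℓ₂) where

  open RealNumbers R renaming (Carrier to ℝ)
  open OnlinePacking R
  open OrderedField R
  private
    module CR = CommutativeRing commutativeRing
    module ≤  = DecTotalOrder decTotalOrder
  open SemiringSum CR.semiring
  open PosetReasoning ≤.poset

  -- Estimates for a single round.

  load-nonNegative : ∀ (a y : ℝ≥0) → 0# ≤ proj₁ a * proj₁ y
  load-nonNegative (_ , 0≤a) (_ , 0≤y) = *-nonNegative 0≤a 0≤y

  -- A rejected round uses `x` with full weight, so an accepted one is also charged for all of `x`.
  -- This gives the total weight 1 + (1 - λ) = 2 - λ.
  choice-load : ∀ (t : [0,1]) (s : Bool) (a x y : ℝ≥0) →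
                proj₁ a * proj₁ (if s then mix t x y else x) ≤
                proj₁ a * proj₁ x + (1# - proj₁ t) * (if s then proj₁ a * proj₁ y else 0#)
  choice-load (t , 0≤t , t≤1) true (a , 0≤a) (x , 0≤x) (y , 0≤y) = begin
    a * (t * x + (1# - t) * y)      ≤⟨ *-monoˡ-≤ 0≤a (+-monoˡ-≤ _ (*-shrinks t≤1 0≤x)) ⟩
    a * (x + (1# - t) * y)          ≈⟨ CR.distribˡ a x _ ⟩
    a * x + a * ((1# - t) * y)      ≈⟨ CR.+-congˡ (CR.*-assoc a _ y) ⟨
    a * x + (a * (1# - t)) * y      ≈⟨ CR.+-congˡ (CR.*-congʳ (CR.*-comm a _)) ⟩
    a * x + ((1# - t) * a) * y      ≈⟨ CR.+-congˡ (CR.*-assoc _ a y) ⟩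
    a * x + (1# - t) * (a * y)      ∎
  choice-load (t , _) false (a , _) (x , _) _ =
    x≤x+y (a * x) (≤.reflexive (CR.sym (CR.zeroʳ (1# - t))))

  -- An accepted round replaces 0 by `y ≥ 0`, and a rejected one raises the weight of `x` from `t`
  -- to 1.
  mix-0≤choice : ∀ (t : [0,1]) (s : Bool) (x y : ℝ≥0) →
                 proj₁ (mix t x 0≥0) ≤ proj₁ (if s then mix t x y else x)
  mix-0≤choice (t , 0≤t , t≤1) true (x , _) (y , 0≤y) =
    +-monoʳ-≤ (t * x) (*-monoˡ-≤ (x≤y⇒0≤y-x t≤1) 0≤y)
  mix-0≤choice (t , 0≤t , t≤1) false (x , 0≤x) _ = begin
    t * x + (1# - t) * 0#  ≈⟨ CR.+-congˡ (CR.zeroʳ _) ⟩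
    t * x + 0#             ≈⟨ CR.+-identityʳ _ ⟩
    t * x                  ≤⟨ *-shrinks t≤1 0≤x ⟩
    x                      ∎

  [2-t]*β*b : ∀ t β b → β * b + (1# - t) * (β * b) ≈ (((1# + 1#) - t) * β) * b
  [2-t]*β*b t β b = begin-equality
    β * b + (1# - t) * (β * b)         ≈⟨ CR.+-congʳ (CR.*-identityˡ _) ⟨
    1# * (β * b) + (1# - t) * (β * b)  ≈⟨ CR.distribʳ _ 1# (1# - t) ⟨
    (1# + (1# - t)) * (β * b)          ≈⟨ CR.*-congʳ (CR.+-assoc 1# 1# (- t)) ⟨
    ((1# + 1#) - t) * (β * b)          ≈⟨ CR.*-assoc _ β b ⟨
    (((1# + 1#) - t) * β) * b          ∎

  -- Feasibility, robustness and consistency of the combined solution.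

  module _ (t : [0,1]) (β : ℝ) (𝒪 : OnlineAlgorithm) (I : Instance)
           (y′ : Vector ℝ≥0 (Instance.m I)) where

    open Instance I
    open IsObjective (proj₂ objective)

    private
      lam : ℝ
      lam = proj₁ t

      0≤lam : 0# ≤ lam
      0≤lam = proj₁ (proj₂ t)

      0≤1-lam : 0# ≤ 1# - lam
      0≤1-lam = x≤y⇒0≤y-x (proj₂ (proj₂ t))

      yᴼ ȳ : Vector ℝ≥0 m
      yᴼ = output 𝒪 I
      ȳ  = algorithm1 𝒪 t β I y′

    Accepted : Pred (Fin m) ℓ₂
    Accepted i = upToRound i A ᵀ upToRound i y′ ≤ᵛ β *ᵛ bound

    accepted? : Decidable Accepted
    accepted? i = upToRound i A ᵀ upToRound i y′ ≤ᵛ? β *ᵛ bound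

    feasible⇒accepted : A ᵀ y′ ≤ᵛ β *ᵛ bound → ∀ i → Accepted i
    feasible⇒accepted feasible i j =
      ≤.trans (sum-upToRound-≤ (λ k → load-nonNegative (A k j) (y′ k)) i) (feasible j)

    ȳ-feasible : A ᵀ yᴼ ≤ᵛ β *ᵛ bound →
                 A ᵀ ȳ ≤ᵛ (((1# + 1#) - lam) * β) *ᵛ bound
    ȳ-feasible feasible j = begin
      sum (λ i → proj₁ (A i j) * proj₁ (ȳ i))
        ≤⟨ sum-mono-≤ (λ i → choice-load t (does (accepted? i)) (A i j) (yᴼ i) (y′ i)) ⟩
      sum (λ i → proj₁ (A i j) * proj₁ (yᴼ i) + (1# - lam) * z i)
        ≈⟨ ∑-distrib-+ (λ i → proj₁ (A i j) * proj₁ (yᴼ i)) (λ i → (1# - lam) * z i) ⟩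
      (A ᵀ yᴼ) j + sum (λ i → (1# - lam) * z i)
        ≈⟨ CR.+-congˡ (*-distribˡ-sum (1# - lam) z) ⟨
      (A ᵀ yᴼ) j + (1# - lam) * sum z
        ≤⟨ +-mono-≤ (feasible j) (*-monoˡ-≤ 0≤1-lam z≤βb) ⟩
      β * bound j + (1# - lam) * (β * bound j)
        ≈⟨ [2-t]*β*b lam β (bound j) ⟩
      (((1# + 1#) - lam) * β) * bound j
        ∎
      where
      z : Vector ℝ m
      z = mask accepted? (λ i → proj₁ (A i j) * proj₁ (y′ i))

      0≤βb : 0# ≤ β * bound j
      -- The load of `yᴼ` lies between 0 and `β * bound j`.
      0≤βb = ≤.trans (sum-nonNegative (λ i → load-nonNegative (A i j) (yᴼ i))) (feasible j)

      z≤βb : sum z ≤ β * bound j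
      -- The load of the truncated advice is definitionally the sum of the truncated loads, so the
      -- test at component `j` is the required prefix bound.
      z≤βb = sum-mask-≤ accepted? (λ i → load-nonNegative (A i j) (y′ i)) 0≤βb
                        (λ i accepted → accepted j)

    ȳ-robust : lam * g yᴼ ≤ g ȳ
    ȳ-robust = begin
      lam * g yᴼ
        -- The added term is nonnegative because `g` takes values in `ℝ≥0`.
        ≤⟨ x≤x+y _ (*-nonNegative 0≤1-lam (proj₂ (proj₁ objective (λ _ → 0≥0)))) ⟩
      lam * g yᴼ + (1# - lam) * g (λ _ → 0≥0)
        ≤⟨ concave t yᴼ (λ _ → 0≥0) ⟩
      g (λ i → mix t (yᴼ i) 0≥0)
        ≤⟨ monotone (λ i → mix-0≤choice t (does (accepted? i)) (yᴼ i) (y′ i)) ⟩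
      g ȳ
        ∎

    ȳ-consistent : A ᵀ y′ ≤ᵛ β *ᵛ bound → (1# - lam) * g y′ ≤ g ȳ
    ȳ-consistent feasible = begin
      (1# - lam) * g y′
        ≤⟨ x≤y+x _ (*-nonNegative 0≤lam (proj₂ (proj₁ objective yᴼ))) ⟩
      lam * g yᴼ + (1# - lam) * g y′
        ≤⟨ concave t yᴼ y′ ⟩
      g (λ i → mix t (yᴼ i) (y′ i))
        ≤⟨ monotone mix≤ȳ ⟩
      g ȳ
        ∎
      where
      mix≤ȳ : ∀ i → proj₁ (mix t (yᴼ i) (y′ i)) ≤ proj₁ (ȳ i)
      -- The two vectors agree only pointwise; `monotone` transfers this to `g` without function
      -- extensionality.
      mix≤ȳ i = ≤.reflexive (CR.reflexive (sym (cong proj₁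
        (if-does-true (accepted? i) (feasible⇒accepted feasible i)))))

mainTheorem1 :
  ∀ {c ℓ₁ ℓ₂ p} (R : RealNumbers c ℓ₁ ℓ₂) →
  let open RealNumbers R
      open OnlinePacking R
      open Instance
  in
  (t : [0,1]) (α β : Carrier) → 1# ≤ α → 1# ≤ β →
  (𝓒 : Pred Instance p) (𝒪 : OnlineAlgorithm) →
  Competitive 𝓒 α 𝒪 → Feasible 𝓒 β 𝒪 →
  (I : Instance) → 𝓒 I → (y′ : Vector ℝ≥0 (m I)) →
  let lam = proj₁ t
      ȳ   = algorithm1 𝒪 t β I y′
  in
    (A I ᵀ ȳ ≤ᵛ (((1# + 1#) - lam) * β) *ᵛ bound I)
  × ((lam * α ⁻¹) · OPT I ≤⁺ [ g I ȳ ])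
  × (A I ᵀ y′ ≤ᵛ β *ᵛ bound I → (1# - lam) * g I y′ ≤ g I ȳ)
mainTheorem1 R t@(_ , 0≤t , t≤1) α β 1≤α _ 𝓒 𝒪 competitive feasible I I∈𝓒 y′ =
    ȳ-feasible t β 𝒪 I y′ (feasible I I∈𝓒)
  -- `0# ≤ 1#` is read off from `0 ≤ t ≤ 1`; with `1 ≤ α` it gives `α ⁻¹ ≉ 0`.
  , ·-scale-≤⁺ (OPT I) 0≤t (1≤x⇒x⁻¹≉0 (trans 0≤t t≤1) 1≤α)
               (competitive I I∈𝓒) (ȳ-robust t β 𝒪 I y′)
  , ȳ-consistent t β 𝒪 I y′
  where
  open RealNumbers R
  open OnlinePacking R
  open OrderedField R
  open Analysis R
  open DecTotalOrder decTotalOrder using (trans)
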